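{- $\alpha_{\mathbb N}(3)\geq\frac23$ and $\alpha_{\mathbb Z}(3)\geq\frac23$.
   Context: $\mathbb N=\{1,2,\ldots\}$. An $\omega$-permutation of a countably infinite set $S$ of integers is a sequence $p_0,p_1,\ldots$ of elements of $S$ in which every element of $S$ occurs exactly once. It contains a monotone arithmetic progression of length $\ell$ if there are indices $i_0<i_1<\cdots<i_{\ell-1}$, $x\in\mathbb Z$ and $d\in\mathbb Z\setminus\{0\}$ such that $p_{i_j}=x+jd$ for all $0\leq j<\ell$. The set $S$ is $\ell$-permutable if it has an $\omega$-permutation containing no monotone arithmetic progression of length $\ell$. For $S\subseteq\mathbb N$ put $\overline d_{\mathbb N}(S)=\limsup_{n\to\infty}|S\cap[1,n]|/n$, and for $T\subseteq\mathbb Z$ put $\overline d_{\mathbb Z}(T)=\limsup_{n\to\infty}|T\cap[-n,n]|/(2n+1)$. For $X\in\{\mathbb N,\mathbb Z\}$, $$\alpha_X(\ell)=\sup\{\overline d_X(S):S\subseteq X\text{ is infinite and }\ell\text{ -permutable}\}.$$ -}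

module Defs where

open import Level using (Level; _⊔_; 0ℓ) renaming (suc to lsuc)
open import Data.Fin.Base as Fin using (Fin; toℕ)
open import Data.Integer.Base as ℤ using (ℤ; +_; 0ℤ; 1ℤ)
open import Data.List.Base using (List; applyUpTo; filter; length)
open import Data.List.Membership.Propositional using (_∈_)
open import Data.Nat.Base as ℕ using (ℕ; suc)
open import Data.Product using (Σ-syntax; ∃-syntax; ∃!; _×_; _,_)
open import Data.Rational.Base as ℚ using (ℚ)
open import Data.Rational.Properties as ℚₚ using (<-dense)
open import Relation.Binary.PropositionalEquality.Core using (_≡_; _≢_)
open import Relation.Nullary.Negation.Core using (¬_)
open import Relation.Unary using (Pred; Decidable; _⊆_; U)

private
  variable
    a b i : Level

-- A real x is represented by its lower cut { q ∈ ℚ ∣ q < x }.  Cuts are not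
-- required to be inhabited or bounded above, so ±∞ are included and arbitrary
-- suprema and infima exist.
record LowerReal (a : Level) : Set (lsuc a) where
  field
    below   : Pred ℚ a
    lower   : ∀ {q r} → r ℚ.< q → below q → below r
    rounded : ∀ {q} → below q → ∃[ r ] (q ℚ.< r × below r)

open LowerReal public

infix 4 _≥_

_≥_ : LowerReal a → LowerReal b → Set (a ⊔ b)
x ≥ y = below y ⊆ below x

fromℚ : ℚ → LowerReal 0ℓ
fromℚ p = record
  { below   = ℚ._< p
  ; lower   = ℚₚ.<-trans
  ; rounded = λ q<p → let r , q<r , r<p = <-dense q<p in r , q<r , r<p
  }

⨆ : {I : Set i} → (I → LowerReal a) → LowerReal (i ⊔ a)
⨆ x = record
  { below   = λ q → ∃[ k ] below (x k) q
  ; lower   = λ r<q (k , q<x) → k , lower (x k) r<q q<x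
  ; rounded = λ (k , q<x) → let r , q<r , r<x = rounded (x k) q<x in r , q<r , k , r<x
  }

-- The intersection of the cuts need not be open (it may contain the infimum
-- itself), hence the intermediate r.
⨅ : {I : Set i} → (I → LowerReal a) → LowerReal (i ⊔ a)
⨅ x = record
  { below   = λ q → ∃[ r ] (q ℚ.< r × ∀ k → below (x k) r)
  ; lower   = λ s<q (r , q<r , r<x) → r , ℚₚ.<-trans s<q q<r , r<x
  ; rounded = λ (r , q<r , r<x) → let s , q<s , s<r = <-dense q<r in s , q<s , r , s<r , r<x
  }

limsup : (ℕ → ℚ) → LowerReal 0ℓ
limsup u = ⨅ λ N → ⨆ λ ((n , _) : Σ[ n ∈ ℕ ] N ℕ.≤ n) → fromℚ (u n)

IsωPermutation : Pred ℤ 0ℓ → (ℕ → ℤ) → Set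
IsωPermutation S p = (∀ n → S (p n)) × (∀ x → S x → ∃! _≡_ (λ n → p n ≡ x))

ContainsMonotoneAP : ℕ → (ℕ → ℤ) → Set
ContainsMonotoneAP ℓ p =
  Σ[ ι ∈ (Fin ℓ → ℕ) ] Σ[ x ∈ ℤ ] Σ[ d ∈ ℤ ]
    (∀ j k → j Fin.< k → ι j ℕ.< ι k)
    × d ≢ 0ℤ
    × (∀ j → p (ι j) ≡ x ℤ.+ + toℕ j ℤ.* d)

Permutable : ℕ → Pred ℤ 0ℓ → Set
Permutable ℓ S = ∃[ p ] (IsωPermutation S p × ¬ ContainsMonotoneAP ℓ p)

Infinite : Pred ℤ 0ℓ → Set
Infinite S = ¬ (Σ[ xs ∈ List ℤ ] ∀ x → S x → x ∈ xs)

-- ∣ S ∩ [x , x + m - 1] ∣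
count : {S : Pred ℤ 0ℓ} → Decidable S → ℤ → ℕ → ℕ
count S? x m = length (filter S? (applyUpTo (λ k → x ℤ.+ + k) m))

-- The term of index n is ∣ S ∩ [1 , n + 1] ∣ / (n + 1), avoiding division by 0.
upperDensityℕ : {S : Pred ℤ 0ℓ} → Decidable S → LowerReal 0ℓ
upperDensityℕ S? = limsup λ n → + count S? 1ℤ (suc n) ℚ./ suc n

upperDensityℤ : {S : Pred ℤ 0ℓ} → Decidable S → LowerReal 0ℓ
upperDensityℤ S? = limsup λ n → + count S? (ℤ.- + n) (suc (2 ℕ.* n)) ℚ./ suc (2 ℕ.* n)

-- Subsets are taken with decidable membership, so that ∣ S ∩ [x , y] ∣ is a
-- natural number; classically this is no restriction.
record Admissible (X : Pred ℤ 0ℓ) (ℓ : ℕ) : Set₁ where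
  field
    S          : Pred ℤ 0ℓ
    S?         : Decidable S
    S⊆X        : S ⊆ X
    infinite   : Infinite S
    permutable : Permutable ℓ S

-- ℕ = {1, 2, …} is the set of positive integers.
αℕ : ℕ → LowerReal (lsuc 0ℓ)
αℕ ℓ = ⨆ λ (A : Admissible ℤ.Positive ℓ) → upperDensityℕ (Admissible.S? A)

αℤ : ℕ → LowerReal (lsuc 0ℓ)
αℤ ℓ = ⨆ λ (A : Admissible U ℓ) → upperDensityℤ (Admissible.S? A)

{-# OPTIONS --safe #-}

-- The set ⋃ⱼ (2·4ʲ , 4ʲ⁺¹] has upper density 2/3 and contains no y together with
-- 2y.  Cut it into blocks of consecutive intervals and shorten each interval of a
-- block at its lower end by the scale e of the block, which bounds all elements of
-- the earlier blocks.  Then for y in the block and ∣x∣ ≤ e the point 2y - x still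
-- falls into a gap of the block, so no progression starts in an earlier block and
-- continues with two terms in this one; two terms in earlier blocks force
-- ∣2y - x∣ ≤ 3e, which is below the block.  So it is enough to list the blocks one
-- after the other, each in bit-reversed order: in a progression x, y, z the terms x
-- and z have equal parity, hence an order putting evens before odds at every binary
-- digit has no monotone progression.  Block k consists of k + 1 intervals, so the
-- shortening costs a proportion O(k / 4ᵏ) of [1 , 4ᵏ⁺¹ e], which tends to 0.

module Submission where

open import Defs
open import Data.Fin.Base using () renaming (zero to fzero; suc to fsuc)
open import Data.Integer.Base as ℤ using (ℤ; +_; -[1+_]; ∣_∣; 0ℤ; 1ℤ; -1ℤ)
import Data.Integer.Properties as ℤₚ
import Data.Integer.Tactic.RingSolver as ℤ-Ring
open import Data.List.Base using (List; []; _∷_; _++_; map; filter; length; applyUpTo)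
open import Data.List.Membership.Propositional using (_∈_)
open import Data.List.Membership.Propositional.Properties
  using (∈-++⁺ˡ; ∈-++⁺ʳ; ∈-++⁻; ∈-map⁺; ∈-map⁻; ∈-filter⁺; ∈-filter⁻; finite)
open import Data.List.Properties using (length-++; filter-++; filter-all; length-applyUpTo)
open import Data.List.Relation.Binary.Sublist.Propositional as Sublist using (_⊆_; []; _∷_; _∷ʳ_)
open import Data.List.Relation.Binary.Sublist.Propositional.Properties using (filter-⊆)
open import Data.List.Relation.Unary.All.Properties using (applyUpTo⁺₁)
open import Data.List.Relation.Unary.All as All using ([]; _∷_)
open import Data.List.Relation.Unary.AllPairs using ([]; _∷_)
open import Data.List.Relation.Unary.Any using (here; there)
open import Data.List.Relation.Unary.Unique.Propositional using (Unique)
import Data.List.Relation.Unary.Unique.Propositional.Properties as Unique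
open import Data.Nat.Base as ℕ using (ℕ; zero; suc; z≤n; s≤s; s<s)
import Data.Nat.Properties as ℕₚ
import Data.Nat.Tactic.RingSolver as ℕ-Ring
open import Data.Product using (∃!)
open import Data.Product.Base using (∃; ∃₂; _×_; _,_; proj₁; proj₂)
open import Data.Rational.Base as ℚ using (_/_)
import Data.Rational.Properties as ℚₚ
import Data.Rational.Unnormalised.Base as ℚᵘ
import Data.Rational.Unnormalised.Properties as ℚᵘₚ
open import Data.Sum.Base using (_⊎_; inj₁; inj₂)
open import Function.Base using (_∘_)
open import Function.Bundles using (mk↣)
open import Level using (0ℓ)
open import Relation.Binary.PropositionalEquality
open import Relation.Nullary using (¬_; yes; no; contradiction; _×-dec_)
open import Relation.Unary using (Pred; Decidable; U)
open import Relation.Unary.Properties using (U?)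
open import Algebra.Properties.AbelianGroup ℤₚ.+-0-abelianGroup using () renaming (∙-cancelˡ to ℤ-+-cancelˡ)

private
  variable
    A B : Set

-- Finite lists without three-term progressions.

⊆-++⁻ : ∀ {as} (xs : List A) {ys} → as ⊆ xs ++ ys →
        ∃₂ λ bs cs → as ≡ bs ++ cs × bs ⊆ xs × cs ⊆ ys
⊆-++⁻ []       p          = [] , _ , refl , [] , p
⊆-++⁻ (x ∷ xs) (_ ∷ʳ p)   = let bs , cs , eq , q , r = ⊆-++⁻ xs p in
  bs , cs , eq , x ∷ʳ q , r
⊆-++⁻ (x ∷ xs) (refl ∷ p) = let bs , cs , eq , q , r = ⊆-++⁻ xs p in
  x ∷ bs , cs , cong (x ∷_) eq , refl ∷ q , r

⊆-map⁻ : ∀ {f : A → B} {as} (xs : List A) → as ⊆ map f xs → ∃ λ bs → as ≡ map f bs × bs ⊆ xs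
⊆-map⁻ []       []         = [] , refl , []
⊆-map⁻ (x ∷ xs) (_ ∷ʳ p)   = let bs , eq , q = ⊆-map⁻ xs p in bs , eq , x ∷ʳ q
⊆-map⁻ (x ∷ xs) (refl ∷ p) = let bs , eq , q = ⊆-map⁻ xs p in x ∷ bs , cong₂ _∷_ refl eq , refl ∷ q

-- Sublists keep the order of positions, so the triples are exactly the candidates for a monotone
-- progression. Difference 0 is also forbidden, which makes the condition one linear equation and
-- changes nothing for lists without repetitions.
APFree : List ℤ → Set
APFree xs = ∀ {x y z} → x ∷ y ∷ z ∷ [] ⊆ xs → x ℤ.+ z ≢ + 2 ℤ.* y

APFree-⊆ : ∀ {xs ys} → xs ⊆ ys → APFree ys → APFree xs
APFree-⊆ xs⊆ys free p = free (Sublist.⊆-trans p xs⊆ys)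

-- The cut between the lists leaves 0, 1, 2 or 3 terms on the left. Only the two mixed cases depend
-- on how the lists interact: parity excludes them for bit reversal, size for the blocks.
APFree-++ : ∀ {xs ys} → APFree xs → APFree ys →
            (∀ {x y z} → x ∈ xs → y ∈ xs → z ∈ ys → x ℤ.+ z ≢ + 2 ℤ.* y) →
            (∀ {x y z} → x ∈ xs → y ∈ ys → z ∈ ys → x ℤ.+ z ≢ + 2 ℤ.* y) →
            APFree (xs ++ ys)
APFree-++ {xs} free₁ free₂ mixed₁ mixed₂ p with ⊆-++⁻ xs p
... | []                   , _      , refl , _ , r = free₂ r
... | _ ∷ []               , _      , refl , q , r =
  mixed₂ (Sublist.lookup q (here refl)) (Sublist.lookup r (here refl)) (Sublist.lookup r (there (here refl)))
... | _ ∷ _ ∷ []           , _      , refl , q , r =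
  mixed₁ (Sublist.lookup q (here refl)) (Sublist.lookup q (there (here refl))) (Sublist.lookup r (here refl))
... | _ ∷ _ ∷ _ ∷ []       , []     , refl , q , _ = free₁ q

-- The bit-reversed order.

even≢odd : ∀ a b → + 2 ℤ.* a ≢ 1ℤ ℤ.+ + 2 ℤ.* b
-- Subtracting `2b` and taking absolute values leaves `2 ∣a - b∣ = 1` in the naturals.
even≢odd a b eq = ℕₚ.even≢odd ∣ a ℤ.- b ∣ 0 (begin
  2 ℕ.* ∣ a ℤ.- b ∣                         ≡⟨ ℤₚ.abs-* (+ 2) (a ℤ.- b) ⟨
  ∣ + 2 ℤ.* (a ℤ.- b) ∣                     ≡⟨ cong ∣_∣ (distrib a b) ⟩
  ∣ + 2 ℤ.* a ℤ.- + 2 ℤ.* b ∣               ≡⟨ cong (λ x → ∣ x ℤ.- + 2 ℤ.* b ∣) eq ⟩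
  ∣ 1ℤ ℤ.+ + 2 ℤ.* b ℤ.- + 2 ℤ.* b ∣        ≡⟨ cong ∣_∣ (cancel b) ⟩
  1                                         ∎)
  where
  open ≡-Reasoning
  distrib : ∀ a b → + 2 ℤ.* (a ℤ.- b) ≡ + 2 ℤ.* a ℤ.- + 2 ℤ.* b
  distrib = ℤ-Ring.solve-∀
  cancel : ∀ b → 1ℤ ℤ.+ + 2 ℤ.* b ℤ.- + 2 ℤ.* b ≡ 1ℤ
  cancel = ℤ-Ring.solve-∀

double double+1 : ℤ → ℤ
double   x = + 2 ℤ.* x
double+1 x = 1ℤ ℤ.+ + 2 ℤ.* x

double-injective : ∀ {x y} → double x ≡ double y → x ≡ y
double-injective = ℤₚ.*-cancelˡ-≡ (+ 2) _ _

double+1-injective : ∀ {x y} → double+1 x ≡ double+1 y → x ≡ y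
double+1-injective = double-injective ∘ ℤ-+-cancelˡ 1ℤ _ _

-- Reading the binary digits from the least significant one, evens precede odds
-- at every level.
bitReversal : ℕ → List ℤ
bitReversal zero    = 0ℤ ∷ -1ℤ ∷ []
bitReversal (suc d) = map double (bitReversal d) ++ map double+1 (bitReversal d)

APFree-map : ∀ f → (∀ {x y z} → f x ℤ.+ f z ≡ + 2 ℤ.* f y → x ℤ.+ z ≡ + 2 ℤ.* y) →
             ∀ {xs} → APFree xs → APFree (map f xs)
APFree-map f reflect {xs} free p with ⊆-map⁻ xs p
... | _ ∷ _ ∷ _ ∷ [] , refl , q = free q ∘ reflect

-- In both mixed cases `x` is in the even half and `z` in the odd half, wherever `y` falls, so
-- `x + z` is odd. Each half is an affine image of the previous list, and affine maps reflect
-- progressions.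
bitReversal-APFree : ∀ d → APFree (bitReversal d)
bitReversal-APFree zero (_ ∷ʳ _ ∷ʳ ())
bitReversal-APFree zero (_ ∷ʳ _ ∷ ())
bitReversal-APFree zero (_ ∷ _ ∷ʳ ())
bitReversal-APFree zero (_ ∷ _ ∷ ())
bitReversal-APFree (suc d) = APFree-++
  (APFree-map double (λ {x} {y} {z} eq → double-injective (trans (reflect₀ x z) eq)) (bitReversal-APFree d))
  (APFree-map double+1
    (λ {x} {y} {z} eq → double+1-injective (ℤ-+-cancelˡ 1ℤ _ _ (trans (reflect₁ x z) (trans eq (reflect₂ y)))))
    (bitReversal-APFree d))
  (λ x∈ _ z∈ → evenOdd (∈-map⁻ double x∈) (∈-map⁻ double+1 z∈))
  (λ x∈ _ z∈ → evenOdd (∈-map⁻ double x∈) (∈-map⁻ double+1 z∈))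
  where
  reflect₀ : ∀ x z → + 2 ℤ.* (x ℤ.+ z) ≡ + 2 ℤ.* x ℤ.+ + 2 ℤ.* z
  reflect₀ = ℤ-Ring.solve-∀
  reflect₁ : ∀ x z → 1ℤ ℤ.+ (1ℤ ℤ.+ + 2 ℤ.* (x ℤ.+ z)) ≡ (1ℤ ℤ.+ + 2 ℤ.* x) ℤ.+ (1ℤ ℤ.+ + 2 ℤ.* z)
  reflect₁ = ℤ-Ring.solve-∀
  reflect₂ : ∀ y → + 2 ℤ.* (1ℤ ℤ.+ + 2 ℤ.* y) ≡ 1ℤ ℤ.+ (1ℤ ℤ.+ + 2 ℤ.* (+ 2 ℤ.* y))
  reflect₂ = ℤ-Ring.solve-∀
  evenOddSum : ∀ x z → + 2 ℤ.* x ℤ.+ (1ℤ ℤ.+ + 2 ℤ.* z) ≡ 1ℤ ℤ.+ + 2 ℤ.* (x ℤ.+ z)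
  evenOddSum = ℤ-Ring.solve-∀

  evenOdd : ∀ {x y z xs zs} → ∃ (λ a → a ∈ xs × x ≡ double a) → ∃ (λ b → b ∈ zs × z ≡ double+1 b) →
          x ℤ.+ z ≢ + 2 ℤ.* y
  evenOdd {y = y} (a , _ , refl) (b , _ , refl) eq = even≢odd y (a ℤ.+ b) (trans (sym eq) (evenOddSum a b))

bitReversal-unique : ∀ d → Unique (bitReversal d)
bitReversal-unique zero    = ((λ ()) ∷ []) ∷ [] ∷ []
bitReversal-unique (suc d) = Unique.++⁺
  (Unique.map⁺ double-injective (bitReversal-unique d))
  (Unique.map⁺ double+1-injective (bitReversal-unique d))
  λ (x∈evens , x∈odds) → let a , _ , x≡2a = ∈-map⁻ double x∈evens
                             b , _ , x≡1+2b = ∈-map⁻ double+1 x∈odds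
                         in even≢odd a b (trans (sym x≡2a) x≡1+2b)

even⊎odd : ∀ n → ∃ λ h → n ≡ 2 ℕ.* h ⊎ n ≡ suc (2 ℕ.* h)
even⊎odd zero = 0 , inj₁ refl
even⊎odd (suc n) with even⊎odd n
... | h , inj₁ n≡2h   = h , inj₂ (cong suc n≡2h)
... | h , inj₂ n≡1+2h = suc h , inj₁ (trans (cong suc n≡1+2h) (cong suc (sym (ℕₚ.+-suc h (h ℕ.+ 0)))))

-- The list runs through `[-2^d , 2^d - 1]`; the cruder range `n ≤ d` suffices and is easy to halve.
-- Pairing `n` with its two's complement `-(n + 1)` lets both halve to the pair of the same `h`,
-- with opposite last digits.
∈-bitReversal : ∀ d {n} → n ℕ.≤ d → + n ∈ bitReversal d × -[1+ n ] ∈ bitReversal d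
∈-bitReversal zero z≤n = here refl , there (here refl)
∈-bitReversal (suc d) {n} n≤1+d with even⊎odd n
... | h , inj₁ refl =
    subst (_∈ bitReversal (suc d)) (sym (ℤₚ.pos-* 2 h)) (∈-++⁺ˡ (∈-map⁺ double (proj₁ ih)))
  , subst (_∈ bitReversal (suc d)) double+1-neg (∈-++⁺ʳ (map double (bitReversal d)) (∈-map⁺ double+1 (proj₂ ih)))
  where
  h≤d : ∀ h → 2 ℕ.* h ℕ.≤ suc d → h ℕ.≤ d
  h≤d zero    _      = z≤n
  h≤d (suc h) (s≤s p) = ℕₚ.≤-trans (s≤s (ℕₚ.m≤m+n h (h ℕ.+ 0))) (ℕₚ.≤-trans (ℕₚ.≤-reflexive (sym (ℕₚ.+-suc h _))) p)
  ih = ∈-bitReversal d (h≤d h n≤1+d)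
  double+1-neg : double+1 -[1+ h ] ≡ -[1+ 2 ℕ.* h ]
  double+1-neg rewrite ℕₚ.+-suc h (h ℕ.+ 0) = refl
... | h , inj₂ refl =
    subst (_∈ bitReversal (suc d)) (cong (λ x → 1ℤ ℤ.+ x) (sym (ℤₚ.pos-* 2 h)))
      (∈-++⁺ʳ (map double (bitReversal d)) (∈-map⁺ double+1 (proj₁ ih)))
  , subst (_∈ bitReversal (suc d)) double-neg (∈-++⁺ˡ (∈-map⁺ double (proj₂ ih)))
  where
  ih = ∈-bitReversal d (ℕₚ.≤-trans (ℕₚ.m≤m+n h (h ℕ.+ 0)) (ℕ.s≤s⁻¹ n≤1+d))
  double-neg : double -[1+ h ] ≡ -[1+ suc (2 ℕ.* h) ]
  double-neg = cong -[1+_] (ℕₚ.+-suc h (h ℕ.+ 0))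

abs≤⇒∈-bitReversal : ∀ {d} x → ∣ x ∣ ℕ.≤ d → x ∈ bitReversal d
abs≤⇒∈-bitReversal (+ n)    ∣x∣≤d = proj₁ (∈-bitReversal _ ∣x∣≤d)
abs≤⇒∈-bitReversal -[1+ n ] ∣x∣≤d = proj₂ (∈-bitReversal _ (ℕₚ.<⇒≤ ∣x∣≤d))

-- Positions in lists and infinite concatenations.

data At {A : Set} : List A → ℕ → A → Set where
  here  : ∀ {x xs} → At (x ∷ xs) zero x
  there : ∀ {x y xs n} → At xs n x → At (y ∷ xs) (suc n) x

-- Appending leaves positions alone. With `At` as a relation, no index bound has to be transported
-- when a prefix grows.
At-++ : ∀ {xs ys : List A} {n x} → At xs n x → At (xs ++ ys) n x
At-++ here      = here
At-++ (there p) = there (At-++ p)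

at : ∀ {xs : List A} {n} → n ℕ.< length xs → ∃ (At xs n)
at {xs = x ∷ xs} {zero}  _         = x , here
at {xs = x ∷ xs} {suc n} (s<s n<l) = let y , p = at n<l in y , there p

At⇒∈ : ∀ {xs : List A} {n x} → At xs n x → x ∈ xs
At⇒∈ here      = here refl
At⇒∈ (there p) = there (At⇒∈ p)

∈⇒At : ∀ {xs : List A} {x} → x ∈ xs → ∃ λ n → At xs n x
∈⇒At (here refl) = 0 , here
∈⇒At (there x∈)  = let n , p = ∈⇒At x∈ in suc n , there p

At-functional : ∀ {xs : List A} {n x y} → At xs n x → At xs n y → x ≡ y
At-functional here      here      = refl
At-functional (there p) (there q) = At-functional p q

At-injective : ∀ {xs : List A} {m n x} → Unique xs → At xs m x → At xs n x → m ≡ n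
At-injective _        here      here      = refl
At-injective (x∉ ∷ _) here      (there q) = contradiction refl (All.lookup x∉ (At⇒∈ q))
At-injective (x∉ ∷ _) (there p) here      = contradiction refl (All.lookup x∉ (At⇒∈ p))
At-injective (_ ∷ u)  (there p) (there q) = cong suc (At-injective u p q)

At⇒⊆₁ : ∀ {xs : List A} {n x} → At xs n x → x ∷ [] ⊆ xs
At⇒⊆₁ p = Sublist.from∈ (At⇒∈ p)

At⇒⊆₂ : ∀ {xs : List A} {m n x y} → m ℕ.< n → At xs m x → At xs n y → x ∷ y ∷ [] ⊆ xs
At⇒⊆₂ _         here      (there q) = refl ∷ At⇒⊆₁ q
At⇒⊆₂ (s<s m<n) (there p) (there q) = _ ∷ʳ At⇒⊆₂ m<n p q

At⇒⊆₃ : ∀ {xs : List A} {l m n x y z} → l ℕ.< m → m ℕ.< n →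
        At xs l x → At xs m y → At xs n z → x ∷ y ∷ z ∷ [] ⊆ xs
At⇒⊆₃ _         m<n       here      (there q) (there r) = refl ∷ At⇒⊆₂ (ℕ.s<s⁻¹ m<n) q r
At⇒⊆₃ (s<s l<m) (s<s m<n) (there p) (there q) (there r) = _ ∷ʳ At⇒⊆₃ l<m m<n p q r

module Concatenation (block : ℕ → List A) (block≢[] : ∀ k → 0 ℕ.< length (block k)) where

  prefix : ℕ → List A
  prefix zero    = []
  prefix (suc k) = prefix k ++ block k

  ∈-prefix : ∀ k {x} → x ∈ prefix k → ∃ λ j → j ℕ.< k × x ∈ block j
  ∈-prefix (suc k) x∈ with ∈-++⁻ (prefix k) x∈
  ... | inj₁ x∈prefix = let j , j<k , x∈block = ∈-prefix k x∈prefix in j , ℕₚ.m<n⇒m<1+n j<k , x∈block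
  ... | inj₂ x∈block  = k , ℕₚ.n<1+n k , x∈block

  At-prefix : ∀ j {k n x} → At (prefix k) n x → At (prefix (j ℕ.+ k)) n x
  At-prefix zero    p = p
  At-prefix (suc j) p = At-++ (At-prefix j p)

  At-prefix-≤ : ∀ {j k n x} → j ℕ.≤ k → At (prefix j) n x → At (prefix k) n x
  At-prefix-≤ {j} {k} j≤k p = subst (λ i → At (prefix i) _ _) (ℕₚ.m∸n+n≡m j≤k) (At-prefix (k ℕ.∸ j) p)

  -- Every block contributes an entry, so position `n` is already filled in `prefix (suc n)`, where
  -- `sequence` reads it.
  length-prefix : ∀ k → k ℕ.≤ length (prefix k)
  length-prefix zero    = z≤n
  length-prefix (suc k) = begin
    suc k                                    ≡⟨ ℕₚ.+-comm 1 k ⟩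
    k ℕ.+ 1                                  ≤⟨ ℕₚ.+-mono-≤ (length-prefix k) (block≢[] k) ⟩
    length (prefix k) ℕ.+ length (block k)   ≡⟨ length-++ (prefix k) ⟨
    length (prefix (suc k))                  ∎
    where open ℕₚ.≤-Reasoning

  sequence : ℕ → A
  sequence n = proj₁ (at {xs = prefix (suc n)} (length-prefix (suc n)))

  At-sequence : ∀ {n k} → n ℕ.< k → At (prefix k) n (sequence n)
  At-sequence {n} n<k = At-prefix-≤ n<k (proj₂ (at {xs = prefix (suc n)} (length-prefix (suc n))))

  sequence-unique : ∀ {k n x} → At (prefix k) n x → sequence n ≡ x
  sequence-unique {k} {n} p = At-functional (At-sequence (ℕₚ.m≤n⊔m k (suc n))) (At-prefix-≤ (ℕₚ.m≤m⊔n k (suc n)) p)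

  sequence-∈ : ∀ n → ∃ λ k → sequence n ∈ block k
  sequence-∈ n = let k , _ , x∈ = ∈-prefix (suc n) (At⇒∈ (At-sequence (ℕₚ.n<1+n n))) in k , x∈

  sequence-surjective : ∀ k {x} → x ∈ block k → ∃ λ n → sequence n ≡ x
  sequence-surjective k x∈ = let n , p = ∈⇒At (∈-++⁺ʳ (prefix k) x∈) in n , sequence-unique {suc k} p

  module _ (unique : ∀ k → Unique (prefix k)) where

    sequence-injective : ∀ {m n} → sequence m ≡ sequence n → m ≡ n
    sequence-injective {m} {n} eq = At-injective (unique k)
      (At-sequence {m} {k} (ℕₚ.m≤m⊔n (suc m) (suc n)))
      (subst (At (prefix k) n) (sym eq) (At-sequence (ℕₚ.m≤n⊔m (suc m) (suc n))))
      where k = suc m ℕ.⊔ suc n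

  -- Reduces the absence of progressions in the infinite sequence to that in its finite prefixes.
  sequence-⊆ : ∀ {l m n} → l ℕ.< m → m ℕ.< n →
               sequence l ∷ sequence m ∷ sequence n ∷ [] ⊆ prefix (suc n)
  sequence-⊆ l<m m<n = At⇒⊆₃ l<m m<n
    (At-sequence (ℕₚ.m<n⇒m<1+n (ℕₚ.<-trans l<m m<n))) (At-sequence (ℕₚ.m<n⇒m<1+n m<n)) (At-sequence (ℕₚ.n<1+n _))

-- The blocks and their gaps.

scale : ℕ → ℕ
scale zero    = 1
-- This is the right end `4 · 4^k · e` of the last interval of block `k`, so it bounds all blocks up
-- to `k`.
scale (suc k) = 4 ℕ.^ suc k ℕ.* scale k

-- With `e = scale k` and `Q = 4^t e`, the intervals `(2Q + e , 4Q]`. They live in the naturals and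
-- are applied to absolute values.
Block : ℕ → Pred ℕ 0ℓ
Block k n = ∃ λ t → t ℕ.< suc k ×
  2 ℕ.* (4 ℕ.^ t ℕ.* scale k) ℕ.+ scale k ℕ.< n × n ℕ.≤ 4 ℕ.* (4 ℕ.^ t ℕ.* scale k)

Block? : ∀ k → Decidable (Block k)
Block? k n = ℕₚ.anyUpTo? (λ t → _ ℕₚ.<? n ×-dec n ℕₚ.≤? _) (suc k)

-- The bound `k < n` makes the union decidable by a finite search. It excludes nothing: elements of
-- block `k` exceed `scale k`, hence `k`.
Spread : Pred ℕ 0ℓ
Spread n = ∃ λ k → k ℕ.< n × Block k n

Spread? : Decidable Spread
Spread? n = ℕₚ.anyUpTo? (λ k → Block? k n) n

m≤4^t*m : ∀ t m → m ℕ.≤ 4 ℕ.^ t ℕ.* m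
m≤4^t*m t m = ℕₚ.m≤n*m m (4 ℕ.^ t) {{ℕₚ.m^n≢0 4 t}}

scale-mono : ∀ {j k} → j ℕ.≤ k → scale j ℕ.≤ scale k
scale-mono {j} {k} j≤k = subst (λ i → scale j ℕ.≤ scale i) (ℕₚ.m∸n+n≡m j≤k) (go (k ℕ.∸ j))
  where
  go : ∀ i → scale j ℕ.≤ scale (i ℕ.+ j)
  go zero    = ℕₚ.≤-refl
  go (suc i) = ℕₚ.≤-trans (go i) (m≤4^t*m (suc (i ℕ.+ j)) _)

n<scale : ∀ n → n ℕ.< scale n
n<scale zero    = s≤s z≤n
n<scale (suc n) = begin-strict
  suc n                           ≤⟨ n<scale n ⟩
  scale n                         <⟨ ℕₚ.m<m*n (scale n) (4 ℕ.^ suc n) {{ℕ.>-nonZero (ℕₚ.≤-<-trans z≤n (n<scale n))}} (ℕₚ.^-monoʳ-< 4 (s≤s (s≤s z≤n)) {0} {suc n} (s≤s z≤n)) ⟩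
  scale n ℕ.* 4 ℕ.^ suc n         ≡⟨ ℕₚ.*-comm (scale n) _ ⟩
  4 ℕ.^ suc n ℕ.* scale n         ∎
  where open ℕₚ.≤-Reasoning

0<scale : ∀ k → 0 ℕ.< scale k
0<scale k = ℕₚ.≤-<-trans z≤n (n<scale k)

-- As `Q ≥ e`, no interval starts below `2e + e`. The factor 3 matches `2∣y∣ + ∣x∣` for two terms of
-- size at most `e`.
scale<Block : ∀ {k n} → Block k n → 3 ℕ.* scale k ℕ.< n
scale<Block {k} {n} (t , _ , lo , _) = begin-strict
  3 ℕ.* scale k                                    ≡⟨ rearrange (scale k) ⟩
  2 ℕ.* scale k ℕ.+ scale k                        ≤⟨ ℕₚ.+-monoˡ-≤ (scale k) (ℕₚ.*-monoʳ-≤ 2 (m≤4^t*m t (scale k))) ⟩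
  2 ℕ.* (4 ℕ.^ t ℕ.* scale k) ℕ.+ scale k          <⟨ lo ⟩
  n                                                ∎
  where
  open ℕₚ.≤-Reasoning
  rearrange : ∀ e → 3 ℕ.* e ≡ 2 ℕ.* e ℕ.+ e
  rearrange = ℕ-Ring.solve-∀

Block≤scale : ∀ {k n} → Block k n → n ℕ.≤ scale (suc k)
Block≤scale {k} {n} (t , t<1+k , _ , hi) = begin
  n                                ≤⟨ hi ⟩
  4 ℕ.* (4 ℕ.^ t ℕ.* scale k)      ≡⟨ ℕₚ.*-assoc 4 (4 ℕ.^ t) (scale k) ⟨
  4 ℕ.^ suc t ℕ.* scale k          ≤⟨ ℕₚ.*-monoˡ-≤ (scale k) (ℕₚ.^-monoʳ-≤ 4 t<1+k) ⟩
  scale (suc k)                    ∎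
  where open ℕₚ.≤-Reasoning

Block⇒Spread : ∀ {k n} → Block k n → Spread n
Block⇒Spread {k} {n} b = k , ℕₚ.<-trans (ℕₚ.<-≤-trans (n<scale k) (ℕₚ.m≤n*m (scale k) 3)) (scale<Block b) , b

-- Doubling (2Q + e , 4Q] gives (4Q + 2e , 8Q], which lies in the gap between this
-- interval and the next one, (8Q + e , 16Q], with room e on both sides.
Block-doubling : ∀ {k l m n} → l ℕ.≤ scale k → 2 ℕ.* m ℕ.≤ l ℕ.+ n → n ℕ.≤ 2 ℕ.* m ℕ.+ l →
                 Block k m → ¬ Block k n
Block-doubling {k} {l} {m} {n} l≤e 2m≤l+n n≤2m+l (t , _ , lo , hi) (u , _ , lo′ , hi′) with u ℕₚ.≤? t
... | yes u≤t = ℕₚ.<-irrefl refl (begin-strict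
    n                                       ≤⟨ hi′ ⟩
    4 ℕ.* (4 ℕ.^ u ℕ.* e)                   ≤⟨ ℕₚ.*-monoʳ-≤ 4 (ℕₚ.*-monoˡ-≤ e (ℕₚ.^-monoʳ-≤ 4 u≤t)) ⟩
    4 ℕ.* Q                                 <⟨ ℕₚ.+-cancelˡ-< e (4 ℕ.* Q) n (begin-strict
      e ℕ.+ 4 ℕ.* Q                           ≤⟨ ℕₚ.m≤n+m _ e ⟩
      e ℕ.+ (e ℕ.+ 4 ℕ.* Q)                   ≡⟨ rearrange e Q ⟩
      2 ℕ.* (2 ℕ.* Q ℕ.+ e)                   <⟨ ℕₚ.*-monoʳ-< 2 lo ⟩
      2 ℕ.* m                                 ≤⟨ 2m≤l+n ⟩
      l ℕ.+ n                                 ≤⟨ ℕₚ.+-monoˡ-≤ n l≤e ⟩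
      e ℕ.+ n                                 ∎) ⟩
    n                                       ∎)
  where
  open ℕₚ.≤-Reasoning
  e Q : ℕ
  e = scale k
  Q = 4 ℕ.^ t ℕ.* e
  rearrange : ∀ e Q → e ℕ.+ (e ℕ.+ 4 ℕ.* Q) ≡ 2 ℕ.* (2 ℕ.* Q ℕ.+ e)
  rearrange = ℕ-Ring.solve-∀
... | no u≰t = ℕₚ.<-irrefl refl (begin-strict
    n                                       ≤⟨ n≤2m+l ⟩
    2 ℕ.* m ℕ.+ l                           ≤⟨ ℕₚ.+-mono-≤ (ℕₚ.*-monoʳ-≤ 2 hi) l≤e ⟩
    2 ℕ.* (4 ℕ.* (4 ℕ.^ t ℕ.* e)) ℕ.+ e     ≡⟨ cong (λ x → 2 ℕ.* x ℕ.+ e) (ℕₚ.*-assoc 4 (4 ℕ.^ t) e) ⟨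
    2 ℕ.* (4 ℕ.^ suc t ℕ.* e) ℕ.+ e         ≤⟨ ℕₚ.+-monoˡ-≤ e (ℕₚ.*-monoʳ-≤ 2 (ℕₚ.*-monoˡ-≤ e (ℕₚ.^-monoʳ-≤ 4 (ℕₚ.≰⇒> u≰t)))) ⟩
    2 ℕ.* (4 ℕ.^ u ℕ.* e) ℕ.+ e             <⟨ lo′ ⟩
    n                                       ∎)
  where
  open ℕₚ.≤-Reasoning
  e : ℕ
  e = scale k

-- With `AP⇒∣z∣≤` this places `∣z∣` within `∣x∣` of `2∣y∣`, in the subtraction-free form that
-- `Block-doubling` takes.
AP⇒2∣y∣≤ : ∀ {x y z} → x ℤ.+ z ≡ + 2 ℤ.* y → 2 ℕ.* ∣ y ∣ ℕ.≤ ∣ x ∣ ℕ.+ ∣ z ∣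
AP⇒2∣y∣≤ {x} {y} {z} eq = begin
  2 ℕ.* ∣ y ∣      ≡⟨ ℤₚ.abs-* (+ 2) y ⟨
  ∣ + 2 ℤ.* y ∣    ≡⟨ cong ∣_∣ eq ⟨
  ∣ x ℤ.+ z ∣      ≤⟨ ℤₚ.∣i+j∣≤∣i∣+∣j∣ x z ⟩
  ∣ x ∣ ℕ.+ ∣ z ∣  ∎
  where open ℕₚ.≤-Reasoning

AP⇒∣z∣≤ : ∀ {x y z} → x ℤ.+ z ≡ + 2 ℤ.* y → ∣ z ∣ ℕ.≤ 2 ℕ.* ∣ y ∣ ℕ.+ ∣ x ∣
AP⇒∣z∣≤ {x} {y} {z} eq = begin
  ∣ z ∣                       ≡⟨ cong ∣_∣ (rearrange x z) ⟩
  ∣ x ℤ.+ z ℤ.- x ∣           ≡⟨ cong (λ w → ∣ w ℤ.- x ∣) eq ⟩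
  ∣ + 2 ℤ.* y ℤ.- x ∣         ≤⟨ ℤₚ.∣i-j∣≤∣i∣+∣j∣ (+ 2 ℤ.* y) x ⟩
  ∣ + 2 ℤ.* y ∣ ℕ.+ ∣ x ∣     ≡⟨ cong (ℕ._+ ∣ x ∣) (ℤₚ.abs-* (+ 2) y) ⟩
  2 ℕ.* ∣ y ∣ ℕ.+ ∣ x ∣       ∎
  where
  open ℕₚ.≤-Reasoning
  rearrange : ∀ x z → z ≡ x ℤ.+ z ℤ.- x
  rearrange = ℤ-Ring.solve-∀

-- The set and its permutation.

module Construction (X : Pred ℤ 0ℓ) (X? : Decidable X) (positive : ∀ n → X (+ suc n)) where

  -- One construction for both densities: `X` will be the positive integers or all of ℤ, and
  -- absolute values make the second set symmetric.
  S : Pred ℤ 0ℓ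
  S x = X x × Spread ∣ x ∣

  S? : Decidable S
  S? x = X? x ×-dec Spread? ∣ x ∣

  InBlock? : ∀ k → Decidable (λ x → X x × Block k ∣ x ∣)
  InBlock? k x = X? x ×-dec Block? k ∣ x ∣

  block : ℕ → List ℤ
  -- Depth `scale (suc k)` covers all absolute values up to `scale (suc k)`, hence the whole block;
  -- filtering keeps the order.
  block k = filter (InBlock? k) (bitReversal (scale (suc k)))

  ∈-block⁺ : ∀ k {x} → X x → Block k ∣ x ∣ → x ∈ block k
  ∈-block⁺ k {x} Xx b = ∈-filter⁺ (InBlock? k) (abs≤⇒∈-bitReversal x (Block≤scale b)) (Xx , b)

  ∈-block⁻ : ∀ k {x} → x ∈ block k → X x × Block k ∣ x ∣
  ∈-block⁻ k x∈ = proj₂ (∈-filter⁻ (InBlock? k) {xs = bitReversal (scale (suc k))} x∈)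

  4*scale∈block : ∀ k → + (4 ℕ.* scale k) ∈ block k
  4*scale∈block k = ∈-block⁺ k (X[4*scale] (0<scale k))
    -- The right end of the interval `t = 0`, which is `(3e , 4e]`. This element shows that the
    -- block is nonempty.
    (0 , s≤s z≤n , 3e<4e , ℕₚ.≤-reflexive (rearrange₂ (scale k)))
    where
    X[4*scale] : ∀ {m} → 0 ℕ.< m → X (+ (4 ℕ.* m))
    X[4*scale] (s≤s _) = positive _
    rearrange₁ : ∀ e → 2 ℕ.* (1 ℕ.* e) ℕ.+ e ≡ 3 ℕ.* e
    rearrange₁ = ℕ-Ring.solve-∀
    rearrange₂ : ∀ e → 4 ℕ.* e ≡ 4 ℕ.* (1 ℕ.* e)
    rearrange₂ = ℕ-Ring.solve-∀
    3e<4e : 2 ℕ.* (1 ℕ.* scale k) ℕ.+ scale k ℕ.< 4 ℕ.* scale k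
    3e<4e = begin-strict
      2 ℕ.* (1 ℕ.* scale k) ℕ.+ scale k  ≡⟨ rearrange₁ (scale k) ⟩
      3 ℕ.* scale k                      <⟨ ℕₚ.m<n+m (3 ℕ.* scale k) (0<scale k) ⟩
      4 ℕ.* scale k                      ∎
      where open ℕₚ.≤-Reasoning

  ∈⇒0<length : ∀ {x : ℤ} {xs} → x ∈ xs → 0 ℕ.< length xs
  ∈⇒0<length (here _)  = s≤s z≤n
  ∈⇒0<length (there _) = s≤s z≤n

  open Concatenation block (λ k → ∈⇒0<length (4*scale∈block k))

  ∈-prefix⇒≤scale : ∀ {k x} → x ∈ prefix k → ∣ x ∣ ℕ.≤ scale k
  ∈-prefix⇒≤scale {k} x∈ = let j , j<k , x∈block = ∈-prefix k x∈ in
    ℕₚ.≤-trans (Block≤scale (proj₂ (∈-block⁻ j x∈block))) (scale-mono j<k)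

  prefix-unique : ∀ k → Unique (prefix k)
  prefix-unique zero    = []
  prefix-unique (suc k) = Unique.++⁺ (prefix-unique k)
    (Unique.filter⁺ (InBlock? k) (bitReversal-unique (scale (suc k))))
    λ (x∈prefix , x∈block) → ℕₚ.<⇒≱ (scale<Block (proj₂ (∈-block⁻ k x∈block)))
      (ℕₚ.≤-trans (∈-prefix⇒≤scale {k} x∈prefix) (ℕₚ.m≤n*m (scale k) 3))

  prefix-APFree : ∀ k → APFree (prefix k)
  prefix-APFree zero    ()
  prefix-APFree (suc k) = APFree-++ (prefix-APFree k)
    (APFree-⊆ (filter-⊆ (InBlock? k) _) (bitReversal-APFree (scale (suc k))))
    -- Two terms in earlier blocks: `∣z∣ ≤ 3e` is below the block.
    (λ {x} {y} {z} x∈ y∈ z∈ eq → ℕₚ.<⇒≱ (scale<Block (proj₂ (∈-block⁻ k z∈))) (begin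
      ∣ z ∣                           ≤⟨ AP⇒∣z∣≤ {x} {y} eq ⟩
      2 ℕ.* ∣ y ∣ ℕ.+ ∣ x ∣           ≤⟨ ℕₚ.+-mono-≤ (ℕₚ.*-monoʳ-≤ 2 (∈-prefix⇒≤scale {k} y∈)) (∈-prefix⇒≤scale {k} x∈) ⟩
      2 ℕ.* scale k ℕ.+ scale k       ≡⟨ rearrange (scale k) ⟩
      3 ℕ.* scale k                   ∎))
    -- One term in an earlier block: `∣x∣ ≤ e` is the slack around `2∣y∣`, and `∣z∣` falls into a
    -- gap.
    (λ {x} {y} {z} x∈ y∈ z∈ eq → Block-doubling {k} {∣ x ∣} (∈-prefix⇒≤scale {k} x∈)
      (AP⇒2∣y∣≤ {x} {y} {z} eq) (AP⇒∣z∣≤ {x} {y} {z} eq)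
      (proj₂ (∈-block⁻ k y∈)) (proj₂ (∈-block⁻ k z∈)))
    where
    open ℕₚ.≤-Reasoning
    rearrange : ∀ e → 2 ℕ.* e ℕ.+ e ≡ 3 ℕ.* e
    rearrange = ℕ-Ring.solve-∀

  sequence-∈S : ∀ n → S (sequence n)
  sequence-∈S n = let k , x∈ = sequence-∈ n
                      Xx , b = ∈-block⁻ k x∈
                  in Xx , Block⇒Spread b

  sequence-exactlyOnce : ∀ x → S x → ∃! _≡_ (λ n → sequence n ≡ x)
  sequence-exactlyOnce x (Xx , k , _ , b) = let n , eq = sequence-surjective k (∈-block⁺ k Xx b) in
    n , eq , λ eq′ → sequence-injective prefix-unique (trans eq (sym eq′))

  permutable : Permutable 3 S
  permutable = sequence , (sequence-∈S , sequence-exactlyOnce) , noAP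
    where
    sum : ∀ x d → (x ℤ.+ + 0 ℤ.* d) ℤ.+ (x ℤ.+ + 2 ℤ.* d) ≡ + 2 ℤ.* (x ℤ.+ + 1 ℤ.* d)
    sum = ℤ-Ring.solve-∀
    noAP : ¬ ContainsMonotoneAP 3 sequence
    noAP (ι , x , d , ι-mono , _ , p[ι]) = prefix-APFree (suc (ι (fsuc (fsuc fzero))))
      (sequence-⊆ (ι-mono fzero (fsuc fzero) (s≤s z≤n)) (ι-mono (fsuc fzero) (fsuc (fsuc fzero)) (s≤s (s≤s z≤n))))
      (trans (cong₂ ℤ._+_ (p[ι] fzero) (p[ι] (fsuc (fsuc fzero))))
        (trans (sum x d) (cong (+ 2 ℤ.*_) (sym (p[ι] (fsuc fzero))))))

  infinite : Infinite S
  infinite (xs , S⊆xs) = finite (mk↣ {to = sequence} (sequence-injective prefix-unique)) xs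
    λ n → S⊆xs _ (sequence-∈S n)

-- Counting elements in intervals.

applyUpTo-cong : ∀ {f g : ℕ → A} → f ≗ g → ∀ n → applyUpTo f n ≡ applyUpTo g n
applyUpTo-cong f≗g zero    = refl
applyUpTo-cong f≗g (suc n) = cong₂ _∷_ (f≗g 0) (applyUpTo-cong (f≗g ∘ suc) n)

applyUpTo-+ : ∀ (f : ℕ → A) m n → applyUpTo f (m ℕ.+ n) ≡ applyUpTo f m ++ applyUpTo (λ k → f (m ℕ.+ k)) n
applyUpTo-+ f zero    n = refl
applyUpTo-+ f (suc m) n = cong (f 0 ∷_) (applyUpTo-+ (f ∘ suc) m n)

module _ {S : Pred ℤ 0ℓ} (S? : Decidable S) where

  count-+ : ∀ x m n → count S? x (m ℕ.+ n) ≡ count S? x m ℕ.+ count S? (x ℤ.+ + m) n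
  count-+ x m n = begin
    length (filter S? (applyUpTo f (m ℕ.+ n)))
      ≡⟨ cong (length ∘ filter S?) (applyUpTo-+ f m n) ⟩
    length (filter S? (applyUpTo f m ++ applyUpTo (λ k → f (m ℕ.+ k)) n))
      ≡⟨ cong length (filter-++ S? (applyUpTo f m) _) ⟩
    length (filter S? (applyUpTo f m) ++ filter S? (applyUpTo (λ k → f (m ℕ.+ k)) n))
      ≡⟨ length-++ (filter S? (applyUpTo f m)) ⟩
    count S? x m ℕ.+ length (filter S? (applyUpTo (λ k → f (m ℕ.+ k)) n))
      ≡⟨ cong (λ l → count S? x m ℕ.+ length (filter S? l)) (applyUpTo-cong (λ k → sym (ℤₚ.+-assoc x (+ m) (+ k))) n) ⟩
    count S? x m ℕ.+ count S? (x ℤ.+ + m) n  ∎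
    where
    open ≡-Reasoning
    f : ℕ → ℤ
    f k = x ℤ.+ + k

  count-all : ∀ x m → (∀ {k} → k ℕ.< m → S (x ℤ.+ + k)) → count S? x m ≡ m
  count-all x m all = trans
    (cong length (filter-all S? (applyUpTo⁺₁ _ m all)))
    (length-applyUpTo _ m)

  module _ (S-neg : ∀ x → S x → S (ℤ.- x)) where

    count₁-neg : ∀ x → count S? x 1 ℕ.≤ count S? (ℤ.- x) 1
    count₁-neg x with S? (x ℤ.+ + 0) | S? (ℤ.- x ℤ.+ + 0)
    ... | no  _   | _       = z≤n
    ... | yes _   | yes _   = ℕₚ.≤-refl
    ... | yes x∈S | no -x∉S = contradiction (subst S (neg-+0 x) (S-neg _ x∈S)) -x∉S
      where
      neg-+0 : ∀ x → ℤ.- (x ℤ.+ + 0) ≡ ℤ.- x ℤ.+ + 0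
      neg-+0 = ℤ-Ring.solve-∀

    -- Induction adds `n + 1` at the end of `[1 , n]` but `-(n + 1)` at the front of `[-n , -1]`,
    -- hence the exchanged summands.
    count-mirror : ∀ n → count S? 1ℤ n ℕ.≤ count S? (ℤ.- + n) n
    count-mirror zero    = z≤n
    count-mirror (suc n) = begin
      count S? 1ℤ (suc n)                                      ≡⟨ cong (count S? 1ℤ) (ℕₚ.+-comm 1 n) ⟩
      count S? 1ℤ (n ℕ.+ 1)                                    ≡⟨ count-+ 1ℤ n 1 ⟩
      count S? 1ℤ n ℕ.+ count S? (+ suc n) 1                   ≤⟨ ℕₚ.+-mono-≤ (count-mirror n) (count₁-neg (+ suc n)) ⟩
      count S? (ℤ.- + n) n ℕ.+ count S? -[1+ n ] 1             ≡⟨ ℕₚ.+-comm (count S? (ℤ.- + n) n) _ ⟩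
      count S? -[1+ n ] 1 ℕ.+ count S? (ℤ.- + n) n             ≡⟨ cong (λ x → count S? -[1+ n ] 1 ℕ.+ count S? x n) (shift n) ⟨
      count S? -[1+ n ] 1 ℕ.+ count S? (-[1+ n ] ℤ.+ + 1) n    ≡⟨ count-+ -[1+ n ] 1 n ⟨
      count S? -[1+ n ] (suc n)                                ∎
      where
      open ℕₚ.≤-Reasoning
      shift : ∀ n → -[1+ n ] ℤ.+ + 1 ≡ ℤ.- + n
      shift zero    = refl
      shift (suc n) = refl

    -- `[-n , n]` splits into `[-n , -1]`, the point 0, whose contribution is dropped, and
    -- `[1 , n]`.
    2*count≤count : ∀ n → 2 ℕ.* count S? 1ℤ n ℕ.≤ count S? (ℤ.- + n) (suc (2 ℕ.* n))
    2*count≤count n = begin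
      2 ℕ.* count S? 1ℤ n                                       ≡⟨ cong (count S? 1ℤ n ℕ.+_) (ℕₚ.+-identityʳ _) ⟩
      count S? 1ℤ n ℕ.+ count S? 1ℤ n                           ≤⟨ ℕₚ.+-mono-≤ (count-mirror n) (ℕₚ.m≤n+m (count S? 1ℤ n) (count S? 0ℤ 1)) ⟩
      count S? (ℤ.- + n) n ℕ.+ (count S? 0ℤ 1 ℕ.+ count S? 1ℤ n) ≡⟨ cong (count S? (ℤ.- + n) n ℕ.+_) (count-+ 0ℤ 1 n) ⟨
      count S? (ℤ.- + n) n ℕ.+ count S? 0ℤ (suc n)              ≡⟨ cong (λ x → count S? (ℤ.- + n) n ℕ.+ count S? x (suc n)) (ℤₚ.+-inverseˡ (+ n)) ⟨
      count S? (ℤ.- + n) n ℕ.+ count S? (ℤ.- + n ℤ.+ + n) (suc n) ≡⟨ count-+ (ℤ.- + n) n (suc n) ⟨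
      count S? (ℤ.- + n) (n ℕ.+ suc n)                          ≡⟨ cong (count S? (ℤ.- + n)) (rearrange n) ⟩
      count S? (ℤ.- + n) (suc (2 ℕ.* n))                        ∎
      where
      open ℕₚ.≤-Reasoning
      rearrange : ∀ n → n ℕ.+ suc n ≡ suc (2 ℕ.* n)
      rearrange = ℕ-Ring.solve-∀

  module _ (k : ℕ) (Block⊆S : ∀ {n} → Block k (suc n) → S (+ suc n)) where

    private
      e : ℕ
      e = scale k

    -- Passing from `Q` to `4Q` gains at least `2Q - e` elements, while `2 · 4Q = 2Q + 3 · 2Q`, so
    -- each step costs `3e`. The initial `2e` is the price of counting nothing in `[1 , e]`.
    count-scale : ∀ t → t ℕ.≤ suc k →
                  2 ℕ.* (4 ℕ.^ t ℕ.* e) ℕ.≤ 3 ℕ.* count S? 1ℤ (4 ℕ.^ t ℕ.* e) ℕ.+ (3 ℕ.* t ℕ.+ 2) ℕ.* e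
    count-scale zero    _ = ℕₚ.≤-trans (ℕₚ.≤-reflexive (rearrange e)) (ℕₚ.m≤n+m (2 ℕ.* e) (3 ℕ.* count S? 1ℤ (1 ℕ.* e)))
      where
      rearrange : ∀ e → 2 ℕ.* (1 ℕ.* e) ≡ 2 ℕ.* e
      rearrange = ℕ-Ring.solve-∀
    count-scale (suc t) t<1+k = begin
      2 ℕ.* (4 ℕ.^ suc t ℕ.* e)
        ≡⟨ rearrange₁ (4 ℕ.^ t) e ⟩
      2 ℕ.* Q ℕ.+ 3 ℕ.* (2 ℕ.* Q)
        ≡⟨ cong (λ x → 2 ℕ.* Q ℕ.+ 3 ℕ.* x) (ℕₚ.m+[n∸m]≡n e≤2Q) ⟨
      2 ℕ.* Q ℕ.+ 3 ℕ.* (e ℕ.+ L)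
        ≤⟨ ℕₚ.+-monoˡ-≤ _ (count-scale t (ℕₚ.<⇒≤ t<1+k)) ⟩
      3 ℕ.* count S? 1ℤ Q ℕ.+ (3 ℕ.* t ℕ.+ 2) ℕ.* e ℕ.+ 3 ℕ.* (e ℕ.+ L)
        ≡⟨ rearrange₂ (count S? 1ℤ Q) t e L ⟩
      3 ℕ.* (count S? 1ℤ Q ℕ.+ L) ℕ.+ (3 ℕ.* suc t ℕ.+ 2) ℕ.* e
        ≤⟨ ℕₚ.+-monoˡ-≤ _ (ℕₚ.*-monoʳ-≤ 3 step) ⟩
      3 ℕ.* count S? 1ℤ (4 ℕ.^ suc t ℕ.* e) ℕ.+ (3 ℕ.* suc t ℕ.+ 2) ℕ.* e
        ∎
      where
      open ℕₚ.≤-Reasoning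
      Q L : ℕ
      Q = 4 ℕ.^ t ℕ.* e
      -- The length of `(2Q + e , 4Q]`; truncated subtraction is exact by `e≤2Q`.
      L = 2 ℕ.* Q ℕ.∸ e
      e≤2Q : e ℕ.≤ 2 ℕ.* Q
      e≤2Q = ℕₚ.≤-trans (m≤4^t*m t e) (ℕₚ.m≤n*m Q 2)
      rearrange₁ : ∀ q e → 2 ℕ.* (4 ℕ.* q ℕ.* e) ≡ 2 ℕ.* (q ℕ.* e) ℕ.+ 3 ℕ.* (2 ℕ.* (q ℕ.* e))
      rearrange₁ = ℕ-Ring.solve-∀
      rearrange₂ : ∀ c t e l → 3 ℕ.* c ℕ.+ (3 ℕ.* t ℕ.+ 2) ℕ.* e ℕ.+ 3 ℕ.* (e ℕ.+ l) ≡
                               3 ℕ.* (c ℕ.+ l) ℕ.+ (3 ℕ.* suc t ℕ.+ 2) ℕ.* e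
      rearrange₂ = ℕ-Ring.solve-∀
      rearrange₃ : ∀ q e l → q ℕ.+ (q ℕ.+ e) ℕ.+ l ≡ 2 ℕ.* q ℕ.+ (e ℕ.+ l)
      rearrange₃ = ℕ-Ring.solve-∀
      rearrange₄ : ∀ q e → 2 ℕ.* (q ℕ.* e) ℕ.+ 2 ℕ.* (q ℕ.* e) ≡ 4 ℕ.* q ℕ.* e
      rearrange₄ = ℕ-Ring.solve-∀
      rearrange₅ : ∀ q e → 2 ℕ.* q ℕ.+ e ≡ q ℕ.+ (q ℕ.+ e)
      rearrange₅ = ℕ-Ring.solve-∀
      4Q : Q ℕ.+ (Q ℕ.+ e) ℕ.+ L ≡ 4 ℕ.^ suc t ℕ.* e
      4Q = trans (rearrange₃ Q e L) (trans (cong (2 ℕ.* Q ℕ.+_) (ℕₚ.m+[n∸m]≡n e≤2Q)) (rearrange₄ (4 ℕ.^ t) e))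
      interval⊆S : ∀ {i} → i ℕ.< L → S (1ℤ ℤ.+ + (Q ℕ.+ (Q ℕ.+ e)) ℤ.+ + i)
      interval⊆S {i} i<L = Block⊆S (t , t<1+k ,
        s≤s (ℕₚ.≤-trans (ℕₚ.≤-reflexive (rearrange₅ Q e)) (ℕₚ.m≤m+n _ i)) ,
        (begin
          suc (Q ℕ.+ (Q ℕ.+ e) ℕ.+ i)  ≡⟨ ℕₚ.+-suc _ i ⟨
          Q ℕ.+ (Q ℕ.+ e) ℕ.+ suc i    ≤⟨ ℕₚ.+-monoʳ-≤ (Q ℕ.+ (Q ℕ.+ e)) i<L ⟩
          Q ℕ.+ (Q ℕ.+ e) ℕ.+ L        ≡⟨ 4Q ⟩
          4 ℕ.^ suc t ℕ.* e            ≡⟨ ℕₚ.*-assoc 4 (4 ℕ.^ t) e ⟩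
          4 ℕ.* Q                      ∎))
      -- Cut `[1 , 4Q]` at `Q` and `2Q + e`: the middle stretch is estimated by 0, the last lies
      -- entirely in `S`.
      step : count S? 1ℤ Q ℕ.+ L ℕ.≤ count S? 1ℤ (4 ℕ.^ suc t ℕ.* e)
      step = begin
        count S? 1ℤ Q ℕ.+ L
          ≤⟨ ℕₚ.+-monoˡ-≤ L (ℕₚ.m≤m+n (count S? 1ℤ Q) _) ⟩
        count S? 1ℤ Q ℕ.+ count S? (1ℤ ℤ.+ + Q) (Q ℕ.+ e) ℕ.+ L
          ≡⟨ cong₂ ℕ._+_ (sym (count-+ 1ℤ Q (Q ℕ.+ e))) (sym (count-all (1ℤ ℤ.+ + (Q ℕ.+ (Q ℕ.+ e))) L interval⊆S)) ⟩
        count S? 1ℤ (Q ℕ.+ (Q ℕ.+ e)) ℕ.+ count S? (1ℤ ℤ.+ + (Q ℕ.+ (Q ℕ.+ e))) L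
          ≡⟨ count-+ 1ℤ (Q ℕ.+ (Q ℕ.+ e)) L ⟨
        count S? 1ℤ (Q ℕ.+ (Q ℕ.+ e) ℕ.+ L)
          ≡⟨ cong (count S? 1ℤ) 4Q ⟩
        count S? 1ℤ (4 ℕ.^ suc t ℕ.* e)
          ∎

-- From counts to rational lower bounds.

[1+n]²≤4^n : ∀ n → suc n ℕ.* suc n ℕ.≤ 4 ℕ.^ n
[1+n]²≤4^n zero    = ℕₚ.≤-refl
[1+n]²≤4^n (suc n) = begin
  suc (suc n) ℕ.* suc (suc n)                    ≤⟨ ℕₚ.m≤m+n _ _ ⟩
  suc (suc n) ℕ.* suc (suc n) ℕ.+ (3 ℕ.* (n ℕ.* n) ℕ.+ 4 ℕ.* n) ≡⟨ rearrange n ⟩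
  4 ℕ.* (suc n ℕ.* suc n)                        ≤⟨ ℕₚ.*-monoʳ-≤ 4 ([1+n]²≤4^n n) ⟩
  4 ℕ.^ suc n                                    ∎
  where
  open ℕₚ.≤-Reasoning
  rearrange : ∀ n → suc (suc n) ℕ.* suc (suc n) ℕ.+ (3 ℕ.* (n ℕ.* n) ℕ.+ 4 ℕ.* n) ≡ 4 ℕ.* (suc n ℕ.* suc n)
  rearrange = ℕ-Ring.solve-∀

-- By count-scale with t = k + 1, this bounds 2N − 3 ∣S ∩ [1 , N]∣ for N = scale (suc k).
error : ℕ → ℕ
error k = (3 ℕ.* suc k ℕ.+ 2) ℕ.* scale k

-- For `b ≤ k` the left side is at most `(3k² + 6k) e`, and `4 (k + 1)²` exceeds `3k² + 6k` by
-- `k² + 2k + 4`. Here `b` will be the denominator of a rational below 2/3. The added 1 yields a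
-- strict bound for ℕ and pays for the 1 in `2n + 1` for ℤ.
error-bound : ∀ {b k} → b ℕ.≤ k → b ℕ.* suc (error k) ℕ.≤ scale (suc k)
error-bound {b} {k} b≤k = begin
  b ℕ.* suc (error k)                          ≤⟨ ℕₚ.*-mono-≤ b≤k (ℕₚ.+-monoˡ-≤ (error k) (0<scale k)) ⟩
  k ℕ.* (e ℕ.+ (3 ℕ.* suc k ℕ.+ 2) ℕ.* e)      ≤⟨ ℕₚ.m≤m+n _ _ ⟩
  k ℕ.* (e ℕ.+ (3 ℕ.* suc k ℕ.+ 2) ℕ.* e) ℕ.+ (k ℕ.* k ℕ.+ 2 ℕ.* k ℕ.+ 4) ℕ.* e
                                               ≡⟨ rearrange k e ⟩
  4 ℕ.* (suc k ℕ.* suc k) ℕ.* e                ≤⟨ ℕₚ.*-monoˡ-≤ e (ℕₚ.*-monoʳ-≤ 4 ([1+n]²≤4^n k)) ⟩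
  scale (suc k)                                ∎
  where
  open ℕₚ.≤-Reasoning
  e : ℕ
  e = scale k
  rearrange : ∀ k e → k ℕ.* (e ℕ.+ (3 ℕ.* suc k ℕ.+ 2) ℕ.* e) ℕ.+ (k ℕ.* k ℕ.+ 2 ℕ.* k ℕ.+ 4) ℕ.* e ≡
                      4 ℕ.* (suc k ℕ.* suc k) ℕ.* e
  rearrange = ℕ-Ring.solve-∀

-- A fraction with denominator `b` below 2/3 misses it by at least `1/(3b)`, whereas `c / suc n`
-- falls short by at most `δ / (3 suc n)`, which is smaller.
<-fromApproximation : ∀ {q δ} c n → q ℚ.< + 2 ℚ./ 3 → 2 ℕ.* suc n ℕ.≤ 3 ℕ.* c ℕ.+ δ → ℚ.↧ₙ q ℕ.* δ ℕ.< suc n →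
                      q ℚ.< + c ℚ./ suc n
<-fromApproximation {ℚ.mkℚ a b-1 _} {δ} c n (ℚ.*<* q<2/3) 2n≤3c+δ bδ<n =
  -- `+ c / suc n` is reduced to lowest terms; unnormalised fractions permit direct
  -- cross-multiplication.
  ℚₚ.toℚᵘ-cancel-< (ℚᵘₚ.<-respʳ-≃ (ℚᵘₚ.≃-sym (ℚₚ.toℚᵘ-fromℚᵘ (ℚᵘ.mkℚᵘ (+ c) n))) (ℚᵘ.*<* (numerators a q<2/3)))
  where
  b : ℕ
  b = suc b-1
  numerators : ∀ a → a ℤ.* + 3 ℤ.< + 2 ℤ.* + b → a ℤ.* + suc n ℤ.< + c ℤ.* + b
  numerators -[1+ _ ] _ = subst (_ ℤ.<_) (ℤₚ.pos-* c b) ℤ.-<+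
  numerators (+ a) 3a<2b = subst₂ ℤ._<_ (ℤₚ.pos-* a (suc n)) (ℤₚ.pos-* c b)
    (ℤ.+<+ (ℕₚ.*-cancelˡ-< 3 _ _ (ℕₚ.+-cancelʳ-< (suc n) _ _ (begin-strict
      3 ℕ.* (a ℕ.* suc n) ℕ.+ suc n      ≡⟨ rearrange₁ a (suc n) ⟩
      -- Integrality: `3a < 2b` is used as `3a + 1 ≤ 2b`, which supplies the spare `suc n`.
      suc (a ℕ.* 3) ℕ.* suc n            ≤⟨ ℕₚ.*-monoˡ-≤ (suc n) (ℤₚ.drop‿+<+ (subst₂ ℤ._<_ (sym (ℤₚ.pos-* a 3)) (sym (ℤₚ.pos-* 2 b)) 3a<2b)) ⟩
      2 ℕ.* b ℕ.* suc n                  ≡⟨ rearrange₂ b (suc n) ⟩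
      b ℕ.* (2 ℕ.* suc n)                ≤⟨ ℕₚ.*-monoʳ-≤ b 2n≤3c+δ ⟩
      b ℕ.* (3 ℕ.* c ℕ.+ δ)              ≡⟨ rearrange₃ b c δ ⟩
      3 ℕ.* (c ℕ.* b) ℕ.+ b ℕ.* δ        <⟨ ℕₚ.+-monoʳ-< (3 ℕ.* (c ℕ.* b)) bδ<n ⟩
      3 ℕ.* (c ℕ.* b) ℕ.+ suc n          ∎))))
    where
    open ℕₚ.≤-Reasoning
    rearrange₁ : ∀ a n → 3 ℕ.* (a ℕ.* n) ℕ.+ n ≡ suc (a ℕ.* 3) ℕ.* n
    rearrange₁ = ℕ-Ring.solve-∀
    rearrange₂ : ∀ b n → 2 ℕ.* b ℕ.* n ≡ b ℕ.* (2 ℕ.* n)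
    rearrange₂ = ℕ-Ring.solve-∀
    rearrange₃ : ∀ b c δ → b ℕ.* (3 ℕ.* c ℕ.+ δ) ≡ 3 ℕ.* (c ℕ.* b) ℕ.+ b ℕ.* δ
    rearrange₃ = ℕ-Ring.solve-∀

-- The cut of an infimum asks for one `r > q` below all the suprema; density provides it between `q`
-- and `p`.
limsup≥ : ∀ {u p} → (∀ {q} → q ℚ.< p → ∀ N → ∃ λ n → N ℕ.≤ n × q ℚ.< u n) → limsup u ≥ fromℚ p
limsup≥ frequently q<p = let r , q<r , r<p = ℚₚ.<-dense q<p in
  r , q<r , λ N → let n , N≤n , r<u = frequently r<p N in (n , N≤n) , r<u

-- The two sets and their upper densities.

positive? : Decidable ℤ.Positive
positive? (+ zero)  = no λ ()
positive? (+ suc n) = yes _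
positive? -[1+ n ]  = no λ ()

module Cℕ = Construction ℤ.Positive positive? (λ _ → _)
module Cℤ = Construction U U? (λ _ → _)

upperDensityℕ≥2/3 : upperDensityℕ Cℕ.S? ≥ fromℚ (+ 2 ℚ./ 3)
-- The sum makes `k` at least `N` and at least the denominator of `q`. The index is the predecessor
-- of `scale (suc k)`, since the term of index `n` counts `[1 , n + 1]`.
upperDensityℕ≥2/3 = limsup≥ λ {q} q<2/3 N → let k = N ℕ.+ ℚ.↧ₙ q in
  frequent q q<2/3 (ℕₚ.m≤m+n N _) (ℕₚ.m≤n+m _ N) (ℕₚ.suc-pred (scale (suc k)) {{ℕ.>-nonZero (0<scale (suc k))}})
  where
  frequent : ∀ q {N k n} → q ℚ.< + 2 ℚ./ 3 → N ℕ.≤ k → ℚ.↧ₙ q ℕ.≤ k → suc n ≡ scale (suc k) →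
             ∃ λ n → N ℕ.≤ n × q ℚ.< + count Cℕ.S? 1ℤ (suc n) ℚ./ suc n
  frequent q {N} {k} {n} q<2/3 N≤k b≤k 1+n≡ = n ,
    ℕₚ.≤-trans N≤k (ℕ.s≤s⁻¹ (subst (suc k ℕ.≤_) (sym 1+n≡) (ℕₚ.<⇒≤ (n<scale (suc k))))) ,
    <-fromApproximation (count Cℕ.S? 1ℤ (suc n)) n q<2/3
      (subst (λ m → 2 ℕ.* m ℕ.≤ 3 ℕ.* count Cℕ.S? 1ℤ m ℕ.+ error k) (sym 1+n≡)
        (count-scale Cℕ.S? k (λ b → _ , Block⇒Spread b) (suc k) ℕₚ.≤-refl))
      (subst (ℚ.↧ₙ q ℕ.* error k ℕ.<_) (sym 1+n≡)
        (ℕₚ.<-≤-trans (ℕₚ.*-monoʳ-< (ℚ.↧ₙ q) (ℕₚ.n<1+n (error k))) (error-bound b≤k)))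

upperDensityℤ≥2/3 : upperDensityℤ Cℤ.S? ≥ fromℚ (+ 2 ℚ./ 3)
upperDensityℤ≥2/3 = limsup≥ λ {q} q<2/3 N → frequent q q<2/3 (ℕₚ.m≤m+n N _) (ℕₚ.m≤n+m _ N)
  where
  S-neg : ∀ x → Cℤ.S x → Cℤ.S (ℤ.- x)
  S-neg x (_ , spread) = _ , subst Spread (sym (ℤₚ.∣-i∣≡∣i∣ x)) spread
  frequent : ∀ q {N k} → q ℚ.< + 2 ℚ./ 3 → N ℕ.≤ k → ℚ.↧ₙ q ℕ.≤ k →
             ∃ λ n → N ℕ.≤ n × q ℚ.< + count Cℤ.S? (ℤ.- + n) (suc (2 ℕ.* n)) ℚ./ suc (2 ℕ.* n)
  frequent q {N} {k} q<2/3 N≤k b≤k = n ,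
    ℕₚ.≤-trans N≤k (ℕₚ.<⇒≤ (ℕₚ.<-trans (ℕₚ.n<1+n k) (n<scale (suc k)))) ,
    -- Here `δ = 2 (error k + 1)`: the one-sided error twice, and 2 more because the window has
    -- length `2n + 1`.
    <-fromApproximation c (2 ℕ.* n) q<2/3
      (begin
        2 ℕ.* suc (2 ℕ.* n)                            ≡⟨ rearrange₁ n ⟩
        2 ℕ.* (2 ℕ.* n) ℕ.+ 2                          ≤⟨ ℕₚ.+-monoˡ-≤ 2 (ℕₚ.*-monoʳ-≤ 2
                                                            (count-scale Cℤ.S? k (λ b → _ , Block⇒Spread b) (suc k) ℕₚ.≤-refl)) ⟩
        2 ℕ.* (3 ℕ.* c₊ ℕ.+ error k) ℕ.+ 2             ≡⟨ rearrange₂ c₊ (error k) ⟩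
        3 ℕ.* (2 ℕ.* c₊) ℕ.+ 2 ℕ.* suc (error k)       ≤⟨ ℕₚ.+-monoˡ-≤ (2 ℕ.* suc (error k))
                                                            (ℕₚ.*-monoʳ-≤ 3 (2*count≤count Cℤ.S? S-neg n)) ⟩
        3 ℕ.* c ℕ.+ 2 ℕ.* suc (error k)                ∎)
      (s≤s (begin
        ℚ.↧ₙ q ℕ.* (2 ℕ.* suc (error k))               ≡⟨ rearrange₃ (ℚ.↧ₙ q) (suc (error k)) ⟩
        2 ℕ.* (ℚ.↧ₙ q ℕ.* suc (error k))               ≤⟨ ℕₚ.*-monoʳ-≤ 2 (error-bound b≤k) ⟩
        2 ℕ.* n                                        ∎))
    where
    open ℕₚ.≤-Reasoning
    n c c₊ : ℕ
    n = scale (suc k)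
    c = count Cℤ.S? (ℤ.- + n) (suc (2 ℕ.* n))
    c₊ = count Cℤ.S? 1ℤ n
    rearrange₁ : ∀ n → 2 ℕ.* suc (2 ℕ.* n) ≡ 2 ℕ.* (2 ℕ.* n) ℕ.+ 2
    rearrange₁ = ℕ-Ring.solve-∀
    rearrange₂ : ∀ c δ → 2 ℕ.* (3 ℕ.* c ℕ.+ δ) ℕ.+ 2 ≡ 3 ℕ.* (2 ℕ.* c) ℕ.+ 2 ℕ.* suc δ
    rearrange₂ = ℕ-Ring.solve-∀
    rearrange₃ : ∀ b δ → b ℕ.* (2 ℕ.* δ) ≡ 2 ℕ.* (b ℕ.* δ)
    rearrange₃ = ℕ-Ring.solve-∀

theorem1p1 : (αℕ 3 ≥ fromℚ (+ 2 / 3)) × (αℤ 3 ≥ fromℚ (+ 2 / 3))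
theorem1p1 =
    (λ q<2/3 → record { S? = Cℕ.S? ; S⊆X = proj₁ ; infinite = Cℕ.infinite ; permutable = Cℕ.permutable }
             , upperDensityℕ≥2/3 q<2/3)
  , (λ q<2/3 → record { S? = Cℤ.S? ; S⊆X = proj₁ ; infinite = Cℤ.infinite ; permutable = Cℤ.permutable }
             , upperDensityℤ≥2/3 q<2/3)
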